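{- Let $(x_k)_{k\ge0}$ be an arbitrary sequence of numbers (or indeterminates), define $a_n=x_n$ if $n=2^k-1$ for some integer $k\ge0$ and $a_n=0$ otherwise, and let $d(n)=\det\left(a_{i+j}\right)_{i,j=0}^{n-1}$ with $d(0)=1$. Then $d(0)=1$, $d(1)=x_0$, $d(2)=-x_1^2$, and for all integers $k,n$ with $1<2^{k-1}<n\le 2^k$, $$d(n)=(-1)^n x_{2^k-1}^{2n-2^k}\,d(2^k-n).$$ -}

module Defs where

open import Algebra.Bundles using (CommutativeRing)
open import Data.Bool.Base using (if_then_else_)
open import Data.Fin.Base using (toℕ)
open import Data.Nat as ℕ using (ℕ; zero; suc; _∸_; _≤_; _<_; z<s; s≤s)
open import Data.Nat.Properties as ℕ using (_≟_; anyUpTo?; ≤-trans; m≤m+n; +-mono-≤; m^n>0)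
open import Data.Product.Base using (∃; _,_)
open import Data.Vec.Functional using (Vector; head; tail; removeAt)
open import Relation.Binary.PropositionalEquality using (_≡_; refl)
open import Relation.Nullary.Decidable using (Dec; does; map′)

n<2^n : ∀ n → n < 2 ℕ.^ n
n<2^n zero    = z<s
n<2^n (suc n) = +-mono-≤ (m^n>0 2 n) (≤-trans (n<2^n n) (m≤m+n _ 0))

k≤2^k∸1 : ∀ k → k ≤ 2 ℕ.^ k ∸ 1
k≤2^k∸1 k = ℕ.∸-monoˡ-≤ 1 (n<2^n k)

powerOfTwoMinusOne? : ∀ n → Dec (∃ λ k → n ≡ 2 ℕ.^ k ∸ 1)
powerOfTwoMinusOne? n =
  map′ (λ (k , _ , eq) → k , eq)
       (λ { (k , refl) → k , s≤s (k≤2^k∸1 k) , refl })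
       (anyUpTo? (λ k → n ≟ 2 ℕ.^ k ∸ 1) (suc n))

module HankelDeterminant {c ℓ} (R : CommutativeRing c ℓ) where

  open CommutativeRing R
  open import Algebra.Properties.Semiring.Exp semiring public using (_^_)
  open import Algebra.Properties.Semiring.Sum semiring using (sum)

  Matrix : ℕ → Set c
  Matrix n = Vector (Vector Carrier n) n

  -- Laplace expansion along the first row.
  det : ∀ {n} → Matrix n → Carrier
  det {zero}  A = 1#
  det {suc n} A =
    sum λ j → (- 1#) ^ toℕ j * (head A j * det λ i → removeAt (tail A i) j)

  hankel : (ℕ → Carrier) → ∀ n → Matrix n
  hankel a n i j = a (toℕ i ℕ.+ toℕ j)

  a : (ℕ → Carrier) → ℕ → Carrier
  a x n = if does (powerOfTwoMinusOne? n) then x n else 0#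

  d : (ℕ → Carrier) → ℕ → Carrier
  d x n = det (hankel (a x) n)

{-# OPTIONS --safe #-}
-- Let h = 2^(k-1) and n = h + p with 0 < p ≤ h.  Inside the n × n Hankel matrix, row h and
-- column h each have a single non-zero entry, namely x_{2h-1} in column, resp. row, h-1.
-- Expanding along both removes the indices h-1 and h at the cost of a factor -x_{2h-1}².
-- The remaining matrix is a Hankel matrix on an index set with a gap, to which the same
-- argument applies with h-2 and h+1; after p such steps the indices 0, …, h-p-1 remain.
-- The sign (-1)^p equals (-1)^n because h is even.
module Submission where

open import Defs
open import Algebra.Bundles using (CommutativeRing)
open import Data.Nat as ℕ using (ℕ; _∸_; _≤_; _<_)
open import Data.Product using (_×_)

open import Data.Bool.Base using (if_then_else_)
open import Data.Fin.Base using (Fin; zero; suc; toℕ; punchIn; inject₁; fromℕ<)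
open import Data.Fin.Properties using (toℕ<n; toℕ-injective; toℕ-fromℕ<; toℕ-inject₁; punchInᵢ≢i)
open import Data.Nat using (zero; suc; z≤n; s≤s; s≤s⁻¹; s<s⁻¹)
import Data.Nat.Properties as ℕ
open import Data.Nat.Solver using (module +-*-Solver)
open import Data.Product using (∃; _,_)
open import Relation.Binary.PropositionalEquality as ≡ using (_≡_; _≢_; cong; cong₂; subst)
import Relation.Binary.Reasoning.Setoid as SetoidReasoning
open import Relation.Nullary.Decidable using (dec-true; dec-false)
open import Relation.Nullary.Negation using (¬_; contradiction)

private module NS = +-*-Solver

-- Removing two indices from a finite set.

-- The position of c once the index punchIn c j has been removed.
punchPos : ∀ {n} → Fin (suc (suc n)) → Fin (suc n) → Fin (suc n)
punchPos         zero    j       = zero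
punchPos         (suc c) zero    = c
punchPos {suc n} (suc c) (suc j) = suc (punchPos c j)

punchIn-punchPos : ∀ {n} (c : Fin (suc (suc n))) j → punchIn (punchIn c j) (punchPos c j) ≡ c
punchIn-punchPos         zero    j       = ≡.refl
punchIn-punchPos         (suc c) zero    = ≡.refl
punchIn-punchPos {suc n} (suc c) (suc j) = cong suc (punchIn-punchPos c j)

-- Both sides enumerate, in increasing order, the indices other than `c` and `punchIn c j`; only the
-- order of removal differs.
punchIn-swap : ∀ {n} (c : Fin (suc (suc n))) j k →
  punchIn (punchIn c j) (punchIn (punchPos c j) k) ≡ punchIn c (punchIn j k)
punchIn-swap         zero    j       k       = ≡.refl
punchIn-swap         (suc c) zero    k       = ≡.refl
punchIn-swap {suc n} (suc c) (suc j) zero    = ≡.refl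
punchIn-swap {suc n} (suc c) (suc j) (suc k) = cong suc (punchIn-swap c j k)

punchIn-inject₁ : ∀ {n} (q : Fin n) → punchIn (inject₁ q) q ≡ suc q
punchIn-inject₁ zero    = ≡.refl
punchIn-inject₁ (suc q) = cong suc (punchIn-inject₁ q)

punchIn-suc : ∀ {n} (q : Fin n) → punchIn (suc q) q ≡ inject₁ q
punchIn-suc zero    = ≡.refl
punchIn-suc (suc q) = cong suc (punchIn-suc q)

-- Either order of removal leaves out the same two neighbours, `q` and `suc q`.
punchIn-inject₁-punchIn : ∀ {n} (q : Fin (suc n)) i →
  punchIn (inject₁ q) (punchIn q i) ≡ punchIn (suc q) (punchIn q i)
punchIn-inject₁-punchIn         zero    i       = ≡.refl
punchIn-inject₁-punchIn {suc n} (suc q) zero    = ≡.refl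
punchIn-inject₁-punchIn {suc n} (suc q) (suc i) = cong suc (punchIn-inject₁-punchIn q i)

-- Enumerating the indices outside a gap.

-- The increasing enumeration of ℕ without q, …, q + 2s - 1.
gap : ℕ → ℕ → ℕ → ℕ
gap zero    s i       = s ℕ.+ s ℕ.+ i
gap (suc q) s zero    = zero
gap (suc q) s (suc i) = suc (gap q s i)

gap-< : ∀ {q} s {i} → i < q → gap q s i ≡ i
gap-< {suc q} s {zero}  i<q = ≡.refl
gap-< {suc q} s {suc i} i<q = cong suc (gap-< s (s<s⁻¹ i<q))

gap-edge : ∀ q s → gap q s q ≡ q ℕ.+ (s ℕ.+ s)
gap-edge zero    s = ℕ.+-identityʳ (s ℕ.+ s)
gap-edge (suc q) s = cong suc (gap-edge q s)

gap-zero : ∀ q i → gap q 0 i ≡ i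
gap-zero zero    i       = ≡.refl
gap-zero (suc q) zero    = ≡.refl
gap-zero (suc q) (suc i) = cong suc (gap-zero q i)

gap-≤ : ∀ q s i → gap q s i ≤ s ℕ.+ s ℕ.+ i
gap-≤ zero    s i       = ℕ.≤-refl
gap-≤ (suc q) s zero    = z≤n
gap-≤ (suc q) s (suc i) = ℕ.≤-trans (s≤s (gap-≤ q s i)) (ℕ.≤-reflexive (≡.sym (ℕ.+-suc (s ℕ.+ s) i)))

-- Position `q` holds the last value before the gap; every later position lies beyond it.
gap≡q⇒i≡q : ∀ q s i → gap (suc q) s i ≡ q → i ≡ q
gap≡q⇒i≡q zero    s zero    eq = ≡.refl
gap≡q⇒i≡q (suc q) s (suc i) eq = cong suc (gap≡q⇒i≡q q s i (ℕ.suc-injective eq))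

-- Positions `q` and `suc q` hold the two values bordering the gap, so dropping them widens it by
-- one at each end.
gap-punchIn : ∀ {n} (q : Fin (suc n)) s i →
  gap (suc (toℕ q)) s (toℕ (punchIn (suc q) (punchIn q i))) ≡ gap (toℕ q) (suc s) (toℕ i)
gap-punchIn         zero    s i       =
  cong suc (≡.trans (ℕ.+-suc (s ℕ.+ s) (toℕ i)) (cong (ℕ._+ toℕ i) (≡.sym (ℕ.+-suc s s))))
gap-punchIn {suc n} (suc q) s zero    = ≡.refl
gap-punchIn {suc n} (suc q) s (suc i) = cong suc (gap-punchIn q s i)

-- This locates the pivot: if `q + s = h`, the values `q - 1` and `gap q s q` bordering the gap sum
-- to 2h - 1.
2*[q+s]≡gap+q : ∀ q s → 2 ℕ.* (q ℕ.+ s) ≡ gap q s q ℕ.+ q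
2*[q+s]≡gap+q q s = ≡.trans
  (NS.solve 2 (λ q s → con 2 :* (q :+ s) := (q :+ (s :+ s)) :+ q) ≡.refl q s)
  (cong (ℕ._+ q) (≡.sym (gap-edge q s)))
  where open NS

q+s≤gap+i : ∀ q s i → q ℕ.+ s ≤ gap q s q ℕ.+ i
q+s≤gap+i q s i = begin
  q ℕ.+ s             ≤⟨ ℕ.+-monoʳ-≤ q (ℕ.m≤m+n s s) ⟩
  q ℕ.+ (s ℕ.+ s)     ≡⟨ gap-edge q s ⟨
  gap q s q           ≤⟨ ℕ.m≤m+n (gap q s q) i ⟩
  gap q s q ℕ.+ i     ∎
  where open ℕ.≤-Reasoning

-- For h = `suc q + s`, this keeps the index sums in the row just past the gap below 4h - 1. The
-- bound `n ≤ 3 * q` enters through the last column, `i = suc n`.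
gap+gap<4*[q+s] : ∀ {q n i} s → n ≤ 3 ℕ.* q → i ≤ suc n →
  suc (gap (suc q) s (suc q) ℕ.+ gap (suc q) s i) < 2 ℕ.* (2 ℕ.* (suc q ℕ.+ s))
gap+gap<4*[q+s] {q} {n} {i} s n≤3q i≤1+n = begin
  2 ℕ.+ (gap (suc q) s (suc q) ℕ.+ gap (suc q) s i)
    ≡⟨ cong (λ j → 2 ℕ.+ (j ℕ.+ gap (suc q) s i)) (gap-edge (suc q) s) ⟩
  2 ℕ.+ ((suc q ℕ.+ (s ℕ.+ s)) ℕ.+ gap (suc q) s i)
    ≤⟨ ℕ.+-monoʳ-≤ (2 ℕ.+ (suc q ℕ.+ (s ℕ.+ s))) (gap-≤ (suc q) s i) ⟩
  2 ℕ.+ ((suc q ℕ.+ (s ℕ.+ s)) ℕ.+ ((s ℕ.+ s) ℕ.+ i))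
    ≤⟨ ℕ.+-monoʳ-≤ (2 ℕ.+ (suc q ℕ.+ (s ℕ.+ s))) (ℕ.+-monoʳ-≤ (s ℕ.+ s) (ℕ.≤-trans i≤1+n (s≤s n≤3q))) ⟩
  2 ℕ.+ ((suc q ℕ.+ (s ℕ.+ s)) ℕ.+ ((s ℕ.+ s) ℕ.+ suc (3 ℕ.* q)))
    ≡⟨ NS.solve 2 (λ q s →
         con 2 :+ (((con 1 :+ q) :+ (s :+ s)) :+ ((s :+ s) :+ (con 1 :+ con 3 :* q)))
         := con 2 :* (con 2 :* ((con 1 :+ q) :+ s))) ≡.refl q s ⟩
  2 ℕ.* (2 ℕ.* (suc q ℕ.+ s)) ∎
  where
  open ℕ.≤-Reasoning
  open NS

-- Powers of two in an interval.

2^e<2^k<2^[2+e]⇒k≡1+e : ∀ {e k} → 2 ℕ.^ e < 2 ℕ.^ k → 2 ℕ.^ k < 2 ℕ.^ (2 ℕ.+ e) → k ≡ suc e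
2^e<2^k<2^[2+e]⇒k≡1+e {e} {k} lower upper = ℕ.≤-antisym
  (s≤s⁻¹ (ℕ.≰⇒> λ 2+e≤k → ℕ.<⇒≱ upper (ℕ.^-monoʳ-≤ 2 2+e≤k)))
  (ℕ.≰⇒> λ k≤e → ℕ.<⇒≱ lower (ℕ.^-monoʳ-≤ 2 k≤e))

suc[2^k∸1]≡2^k : ∀ k → suc (2 ℕ.^ k ∸ 1) ≡ 2 ℕ.^ k
suc[2^k∸1]≡2^k k = ℕ.m+[n∸m]≡n (ℕ.m^n>0 2 k)

module _ {c ℓ} (R : CommutativeRing c ℓ) where

  open CommutativeRing R hiding (zero)
  open HankelDeterminant R
  open import Algebra.Properties.Ring ring using (-1*x≈-x; -‿involutive)
  open import Algebra.Properties.Semiring.Exp semiring using (^-congˡ; ^-homo-*; ^-assocʳ)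
  open import Algebra.Properties.CommutativeSemiring.Exp commutativeSemiring using (^-distrib-*)
  open import Algebra.Properties.CommutativeMonoid.Sum +-commutativeMonoid using (sum-remove)
  open import Algebra.Properties.Semiring.Sum semiring
    using (sum; sum-cong-≋; sum-replicate-zero; *-distribˡ-sum)
  open import Algebra.Solver.CommutativeMonoid *-commutativeMonoid using (solve; _⊕_; _⊜_; id)
  open SetoidReasoning setoid

  -- Signs.

  ε : ∀ {n} → Fin n → Carrier
  ε i = (- 1#) ^ toℕ i

  -1*-1≈1 : - 1# * - 1# ≈ 1#
  -1*-1≈1 = trans (-1*x≈-x (- 1#)) (-‿involutive 1#)

  -1^n*-1^n≈1 : ∀ n → (- 1#) ^ n * (- 1#) ^ n ≈ 1#
  -1^n*-1^n≈1 zero    = *-identityˡ 1#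
  -1^n*-1^n≈1 (suc n) = begin
    (- 1# * (- 1#) ^ n) * (- 1# * (- 1#) ^ n)
      ≈⟨ solve 2 (λ m e → (m ⊕ e) ⊕ (m ⊕ e) ⊜ (m ⊕ m) ⊕ (e ⊕ e)) refl (- 1#) ((- 1#) ^ n) ⟩
    (- 1# * - 1#) * ((- 1#) ^ n * (- 1#) ^ n)
      ≈⟨ *-cong -1*-1≈1 (-1^n*-1^n≈1 n) ⟩
    1# * 1#
      ≈⟨ *-identityˡ 1# ⟩
    1# ∎

  -1^[2*m+n]≈-1^n : ∀ m n → (- 1#) ^ (2 ℕ.* m ℕ.+ n) ≈ (- 1#) ^ n
  -1^[2*m+n]≈-1^n m n = begin
    (- 1#) ^ (2 ℕ.* m ℕ.+ n)               ≈⟨ ^-homo-* (- 1#) (2 ℕ.* m) n ⟩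
    (- 1#) ^ (2 ℕ.* m) * (- 1#) ^ n        ≡⟨ cong (λ k → (- 1#) ^ (m ℕ.+ k) * (- 1#) ^ n) (ℕ.+-identityʳ m) ⟩
    (- 1#) ^ (m ℕ.+ m) * (- 1#) ^ n        ≈⟨ *-congʳ (^-homo-* (- 1#) m m) ⟩
    ((- 1#) ^ m * (- 1#) ^ m) * (- 1#) ^ n ≈⟨ *-congʳ (-1^n*-1^n≈1 m) ⟩
    1# * (- 1#) ^ n                        ≈⟨ *-identityˡ _ ⟩
    (- 1#) ^ n                             ∎

  -[y*y]^p≈-1^p*y^[2*p] : ∀ y p → (- (y * y)) ^ p ≈ (- 1#) ^ p * y ^ (2 ℕ.* p)
  -[y*y]^p≈-1^p*y^[2*p] y p = begin
    (- (y * y)) ^ p               ≈⟨ ^-congˡ p (-1*x≈-x (y * y)) ⟨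
    (- 1# * (y * y)) ^ p          ≈⟨ ^-distrib-* (- 1#) (y * y) p ⟩
    (- 1#) ^ p * (y * y) ^ p      ≈⟨ *-congˡ (^-congˡ p (*-congˡ (*-identityʳ y))) ⟨
    (- 1#) ^ p * (y ^ 2) ^ p      ≈⟨ *-congˡ (^-assocʳ y 2 p) ⟩
    (- 1#) ^ p * y ^ (2 ℕ.* p)    ∎

  -- The two sides remove the columns `c` and `punchIn c j` in opposite orders; the transposition
  -- accounts for `- 1#`.
  ε-punchIn : ∀ {n} (c : Fin (suc (suc n))) j →
    ε (punchIn c j) * ε (punchPos c j) ≈ - 1# * (ε c * ε j)
  ε-punchIn zero j =
    solve 2 (λ m e → (m ⊕ e) ⊕ id ⊜ m ⊕ (id ⊕ e)) refl (- 1#) (ε j)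
  ε-punchIn (suc c) zero = begin
    1# * ε c                        ≈⟨ *-congʳ -1*-1≈1 ⟨
    (- 1# * - 1#) * ε c             ≈⟨ solve 2 (λ m e → (m ⊕ m) ⊕ e ⊜ m ⊕ ((m ⊕ e) ⊕ id)) refl (- 1#) (ε c) ⟩
    - 1# * ((- 1# * ε c) * 1#)      ∎
  ε-punchIn {suc n} (suc c) (suc j) = begin
    (- 1# * ε (punchIn c j)) * (- 1# * ε (punchPos c j))
      ≈⟨ solve 3 (λ m a b → (m ⊕ a) ⊕ (m ⊕ b) ⊜ (m ⊕ m) ⊕ (a ⊕ b)) refl (- 1#) (ε (punchIn c j)) (ε (punchPos c j)) ⟩
    (- 1# * - 1#) * (ε (punchIn c j) * ε (punchPos c j))
      ≈⟨ *-congˡ (ε-punchIn c j) ⟩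
    (- 1# * - 1#) * (- 1# * (ε c * ε j))
      ≈⟨ solve 3 (λ m a b → (m ⊕ m) ⊕ (m ⊕ (a ⊕ b)) ⊜ m ⊕ ((m ⊕ a) ⊕ (m ⊕ b))) refl (- 1#) (ε c) (ε j) ⟩
    - 1# * ((- 1# * ε c) * (- 1# * ε j)) ∎

  -- Expansion of determinants at a single entry.

  minor : ∀ {n} → Matrix (suc n) → Fin (suc n) → Fin (suc n) → Matrix n
  minor A r c i j = A (punchIn r i) (punchIn c j)

  det-cong : ∀ {n} {A B : Matrix n} → (∀ i j → A i j ≈ B i j) → det A ≈ det B
  det-cong {zero}  A≈B = refl
  det-cong {suc n} A≈B = sum-cong-≋ λ j →
    *-congˡ {ε j} (*-cong (A≈B zero j) (det-cong λ i k → A≈B (suc i) (punchIn j k)))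

  sum-zero : ∀ {n} {f : Fin n → Carrier} → (∀ i → f i ≈ 0#) → sum f ≈ 0#
  sum-zero {n} f≈0 = trans (sum-cong-≋ f≈0) (sum-replicate-zero n)

  sum-single : ∀ {n} (f : Fin (suc n) → Carrier) i → (∀ j → f (punchIn i j) ≈ 0#) → sum f ≈ f i
  sum-single f i f≈0 = begin
    sum f                                ≈⟨ sum-remove {i = i} f ⟩
    f i + sum (λ j → f (punchIn i j))    ≈⟨ +-congˡ (sum-zero f≈0) ⟩
    f i + 0#                             ≈⟨ +-identityʳ (f i) ⟩
    f i                                  ∎

  laplaceTerm : ∀ {n} → Matrix (suc n) → Fin (suc n) → Carrier
  laplaceTerm A j = ε j * (A zero j * det (minor A zero j))

  -- Unlike the usual cofactor, this includes the entry itself: it is a whole summand of an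
  -- expansion.
  cofactor : ∀ {n} → Matrix (suc n) → Fin (suc n) → Fin (suc n) → Carrier
  cofactor A r c = (ε r * ε c) * (A r c * det (minor A r c))

  cofactor-zero : ∀ {n} (A : Matrix (suc n)) {r c} → A r c ≈ 0# → cofactor A r c ≈ 0#
  cofactor-zero A {r} {c} A≈0 = begin
    (ε r * ε c) * (A r c * det (minor A r c))  ≈⟨ *-congˡ (*-congʳ A≈0) ⟩
    (ε r * ε c) * (0# * det (minor A r c))     ≈⟨ *-congˡ (zeroˡ _) ⟩
    (ε r * ε c) * 0#                           ≈⟨ zeroʳ _ ⟩
    0#                                         ∎

  -- The inductive step of an expansion at one entry: every minor of the first row either
  -- vanishes or is expanded at the same entry.
  det-expand-step : ∀ {n} (A : Matrix (suc (suc n))) r c →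
    A zero c * det (minor A zero c) ≈ 0# →
    (∀ j → det (minor A zero (punchIn c j)) ≈ cofactor (minor A zero (punchIn c j)) r (punchPos c j)) →
    det A ≈ cofactor A (suc r) c
  det-expand-step {n} A r c Ac≈0 expand = begin
    det A
      ≈⟨ sum-remove {i = c} term ⟩
    term c + sum (λ j → term (punchIn c j))
      ≈⟨ +-cong (trans (*-congˡ Ac≈0) (zeroʳ _)) (sum-cong-≋ step) ⟩
    0# + sum (λ j → K * laplaceTerm M j)
      ≈⟨ +-identityˡ _ ⟩
    sum (λ j → K * laplaceTerm M j)
      ≈⟨ *-distribˡ-sum K (laplaceTerm M) ⟨
    K * det M
      ≈⟨ *-assoc _ _ _ ⟩
    cofactor A (suc r) c ∎
    where
    M = minor A (suc r) c
    K = (ε (suc r) * ε c) * A (suc r) c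

    term = laplaceTerm A

    step : ∀ j → term (punchIn c j) ≈ K * laplaceTerm M j
    step j = begin
      ε pj * (b * det B)
        ≈⟨ *-congˡ (*-congˡ (expand j)) ⟩
      ε pj * (b * ((ε r * ε s) * (B r s * det (minor B r s))))
        ≈⟨ *-congˡ (*-congˡ (*-congˡ (*-cong
             (reflexive (cong (A (suc r)) (punchIn-punchPos c j)))
             (det-cong λ i k → reflexive (cong (A (suc (punchIn r i))) (punchIn-swap c j k)))))) ⟩
      ε pj * (b * ((ε r * ε s) * (y * D)))
        ≈⟨ solve 6 (λ p b r s y d → p ⊕ (b ⊕ ((r ⊕ s) ⊕ (y ⊕ d))) ⊜ (p ⊕ s) ⊕ (r ⊕ (b ⊕ (y ⊕ d))))
             refl (ε pj) b (ε r) (ε s) y D ⟩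
      (ε pj * ε s) * (ε r * (b * (y * D)))
        -- Reversing the order of the two column removals costs `- 1#`, which turns `ε r` into
        -- `ε (suc r)`.
        ≈⟨ *-congʳ (ε-punchIn c j) ⟩
      (- 1# * (ε c * ε j)) * (ε r * (b * (y * D)))
        ≈⟨ solve 7 (λ m c j r b y d → (m ⊕ (c ⊕ j)) ⊕ (r ⊕ (b ⊕ (y ⊕ d))) ⊜ (((m ⊕ r) ⊕ c) ⊕ y) ⊕ (j ⊕ (b ⊕ d)))
             refl (- 1#) (ε c) (ε j) (ε r) b y D ⟩
      K * (ε j * (b * D)) ∎
      where
      pj = punchIn c j
      s  = punchPos c j
      B  = minor A zero pj
      b  = A zero pj
      y  = A (suc r) c
      D  = det (minor M zero j)

  laplaceTerm≈cofactor : ∀ {n} (A : Matrix (suc n)) c → laplaceTerm A c ≈ cofactor A zero c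
  laplaceTerm≈cofactor A c = *-congʳ (sym (*-identityˡ (ε c)))

  -- Deleting the first row and a column other than `c` leaves a row of the same shape, so induction
  -- on `r` applies.
  det-single-row : ∀ {n} (A : Matrix (suc n)) r c →
    (∀ j → A r (punchIn c j) ≈ 0#) → det A ≈ cofactor A r c
  det-single-row A zero c row≈0 = trans
    (sum-single (laplaceTerm A) c λ j → trans (laplaceTerm≈cofactor A (punchIn c j)) (cofactor-zero A (row≈0 j)))
    (laplaceTerm≈cofactor A c)
  det-single-row {suc n} A (suc r) c row≈0 = det-expand-step A r c
    -- Without column `c` the row is entirely zero, so expanding the minor at any of its entries
    -- gives zero; column `r` is just an index at hand.
    (trans (*-congˡ (trans (det-single-row (minor A zero c) r r (λ j → row≈0 (punchIn r j)))
                           (cofactor-zero (minor A zero c) (row≈0 r))))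
           (zeroʳ _))
    (λ j → det-single-row (minor A zero (punchIn c j)) r (punchPos c j) λ k →
      trans (reflexive (cong (A (suc r)) (punchIn-swap c j k))) (row≈0 (punchIn j k)))

  -- Since `det` expands along the first row, columns need an induction of their own.
  det-single-column : ∀ {n} (A : Matrix (suc n)) r c →
    (∀ i → A (punchIn r i) c ≈ 0#) → det A ≈ cofactor A r c
  det-single-column {zero} A zero zero column≈0 = det-single-row A zero zero λ ()
  -- Every minor away from `c` still contains that column, now entirely zero, so only the term at
  -- `c` survives.
  det-single-column {suc n} A zero c column≈0 = trans
    (sum-single (laplaceTerm A) c λ j → trans (*-congˡ (*-congˡ (minor-zero j))) (trans (*-congˡ (zeroʳ _)) (zeroʳ _)))
    (laplaceTerm≈cofactor A c)
    where
    column′≈0 : ∀ j i → minor A zero (punchIn c j) i (punchPos c j) ≈ 0#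
    column′≈0 j i = trans (reflexive (cong (A (suc i)) (punchIn-punchPos c j))) (column≈0 i)

    minor-zero : ∀ j → det (minor A zero (punchIn c j)) ≈ 0#
    minor-zero j = trans
      (det-single-column (minor A zero (punchIn c j)) zero (punchPos c j) (λ i → column′≈0 j (suc i)))
      (cofactor-zero (minor A zero (punchIn c j)) (column′≈0 j zero))
  det-single-column {suc n} A (suc r) c column≈0 = det-expand-step A r c
    (trans (*-congʳ (column≈0 zero)) (zeroˡ _))
    (λ j → det-single-column (minor A zero (punchIn c j)) r (punchPos c j) λ i →
      trans (reflexive (cong (A (suc (punchIn r i))) (punchIn-punchPos c j))) (column≈0 (suc i)))

  -- Expanding at `(suc q, q)` and then at `(q, suc q)` gives the signs `ε (suc q) * ε q` and
  -- `ε q * ε q`, whose product is `- 1#`.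
  det-single-row-column : ∀ {n} (A : Matrix (suc (suc n))) (q : Fin (suc n)) →
    (∀ j → A (suc q) (punchIn (inject₁ q) j) ≈ 0#) →
    (∀ i → A (punchIn (inject₁ q) i) (suc q) ≈ 0#) →
    det A ≈ - (A (suc q) (inject₁ q) * A (inject₁ q) (suc q)) *
      det (λ i j → A (punchIn (suc q) (punchIn q i)) (punchIn (suc q) (punchIn q j)))
  det-single-row-column A q row≈0 column≈0 = begin
    det A
      ≈⟨ det-single-row A (suc q) (inject₁ q) row≈0 ⟩
    (ε (suc q) * ε (inject₁ q)) * (u * det B)
      -- Row `q` and column `q` of `B` come from row `q` and column `suc q` of `A`.
      ≈⟨ *-cong (*-congˡ (reflexive (cong ((- 1#) ^_) (toℕ-inject₁ q))))
           (*-congˡ (det-single-column B q q λ i → trans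
             (reflexive (cong₂ A (≡.sym (punchIn-inject₁-punchIn q i)) (punchIn-inject₁ q)))
             (column≈0 (punchIn q i)))) ⟩
    ((- 1# * ε q) * ε q) * (u * ((ε q * ε q) * (B q q * det (minor B q q))))
      ≈⟨ *-congˡ (*-congˡ (*-congˡ (*-cong
           (reflexive (cong₂ A (punchIn-suc q) (punchIn-inject₁ q)))
           (det-cong λ i j → reflexive (cong (A _) (punchIn-inject₁-punchIn q j)))))) ⟩
    ((- 1# * ε q) * ε q) * (u * ((ε q * ε q) * (v * D)))
      ≈⟨ solve 5 (λ m e u v d → ((m ⊕ e) ⊕ e) ⊕ (u ⊕ ((e ⊕ e) ⊕ (v ⊕ d))) ⊜ (e ⊕ e) ⊕ ((e ⊕ e) ⊕ ((m ⊕ (u ⊕ v)) ⊕ d)))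
           refl (- 1#) (ε q) u v D ⟩
    (ε q * ε q) * ((ε q * ε q) * ((- 1# * (u * v)) * D))
      ≈⟨ *-cong (-1^n*-1^n≈1 (toℕ q)) (*-cong (-1^n*-1^n≈1 (toℕ q)) (*-congʳ (-1*x≈-x (u * v)))) ⟩
    1# * (1# * (- (u * v) * D))
      ≈⟨ trans (*-identityˡ _) (*-identityˡ _) ⟩
    - (u * v) * D ∎
    where
    B = minor A (suc q) (inject₁ q)
    u = A (suc q) (inject₁ q)
    v = A (inject₁ q) (suc q)
    D = det (λ i j → A (punchIn (suc q) (punchIn q i)) (punchIn (suc q) (punchIn q j)))

  -- Hankel determinants with a gap in the index set.

  module _ (x : ℕ → Carrier) where

    a-power : ∀ k {t} → t ≡ 2 ℕ.^ k ∸ 1 → a x t ≈ x (2 ℕ.^ k ∸ 1)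
    a-power k ≡.refl =
      reflexive (cong (if_then x (2 ℕ.^ k ∸ 1) else 0#) (dec-true (powerOfTwoMinusOne? _) (k , ≡.refl)))

    -- The only power of two strictly between `2 ^ e` and `2 ^ (2 + e)` is `2 ^ suc e`. Bounding
    -- `suc t` avoids truncated subtraction.
    a-nonPower : ∀ e {t} → 2 ℕ.^ e < suc t → suc t < 2 ℕ.^ (2 ℕ.+ e) → suc t ≢ 2 ℕ.^ suc e → a x t ≈ 0#
    a-nonPower e {t} lower upper t≢ =
      reflexive (cong (if_then x t else 0#) (dec-false (powerOfTwoMinusOne? t) nonPower))
      where
      nonPower : ¬ ∃ λ k → t ≡ 2 ℕ.^ k ∸ 1
      nonPower (k , t≡) = t≢ (≡.trans 1+t≡2^k (cong (2 ℕ.^_)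
        (2^e<2^k<2^[2+e]⇒k≡1+e {e} {k} (subst (2 ℕ.^ e <_) 1+t≡2^k lower) (subst (_< 2 ℕ.^ (2 ℕ.+ e)) 1+t≡2^k upper))))
        where
        1+t≡2^k : suc t ≡ 2 ℕ.^ k
        1+t≡2^k = ≡.trans (cong suc t≡) (suc[2^k∸1]≡2^k k)

    -- A principal submatrix of the infinite Hankel matrix; `s` counts the index pairs already
    -- removed.
    gapHankel : ℕ → ℕ → ∀ n → Matrix n
    gapHankel q s n i j = a x (gap q s (toℕ i) ℕ.+ gap q s (toℕ j))

    module _ (e : ℕ) where

      y : Carrier
      y = x (2 ℕ.^ suc e ∸ 1)

      -- Positions `q` and `suc q` border the gap. Each step lowers the start of the gap and raises
      -- `s`, so their sum stays h = `2 ^ e` and the pivot is always `y`.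
      det-gapHankel-step : ∀ {n} (q : Fin (suc n)) s → suc (toℕ q) ℕ.+ s ≡ 2 ℕ.^ e → n ≤ 3 ℕ.* toℕ q →
        det (gapHankel (suc (toℕ q)) s (suc (suc n))) ≈ - (y * y) * det (gapHankel (toℕ q) (suc s) n)
      det-gapHankel-step {n} q s Q+s≡h n≤3q = begin
        det A
          ≈⟨ det-single-row-column A q row≈0
               -- Index sums are symmetric, so the column vanishes where the row does.
               (λ i → trans (reflexive (cong (a x) (ℕ.+-comm (g (toℕ (punchIn (inject₁ q) i))) (g Q)))) (row≈0 i)) ⟩
        - (A (suc q) (inject₁ q) * A (inject₁ q) (suc q)) *
          det (λ i j → A (punchIn (suc q) (punchIn q i)) (punchIn (suc q) (punchIn q j)))
          ≈⟨ *-cong (-‿cong (*-cong pivot (trans (reflexive (cong (a x) (ℕ.+-comm (g (toℕ (inject₁ q))) (g Q)))) pivot)))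
               (det-cong λ i j → reflexive (cong₂ (λ u v → a x (u ℕ.+ v)) (gap-punchIn q s i) (gap-punchIn q s j))) ⟩
        - (y * y) * det (gapHankel (toℕ q) (suc s) n) ∎
        where
        Q = suc (toℕ q)
        g = gap Q s
        A = gapHankel Q s (suc (suc n))

        2h≡gQ+Q : 2 ℕ.^ suc e ≡ g Q ℕ.+ Q
        2h≡gQ+Q = ≡.trans (cong (2 ℕ.*_) (≡.sym Q+s≡h)) (2*[q+s]≡gap+q Q s)

        pivot : a x (g Q ℕ.+ g (toℕ (inject₁ q))) ≈ y
        pivot = a-power (suc e) (cong ℕ.pred (≡.trans
          (≡.trans (≡.sym (ℕ.+-suc (g Q) _))
            (cong (λ i → g Q ℕ.+ suc i) (≡.trans (cong g (toℕ-inject₁ q)) (gap-< s ℕ.≤-refl))))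
          (≡.sym 2h≡gQ+Q)))

        row≈0 : ∀ j → A (suc q) (punchIn (inject₁ q) j) ≈ 0#
        -- The index sum plus one lies strictly between h and 4h. Were it 2h, the column would sit
        -- at position `q`, which `punchIn` skips.
        row≈0 j = a-nonPower e
          (subst (_< suc (g Q ℕ.+ _)) Q+s≡h (s≤s (q+s≤gap+i Q s _)))
          (subst (λ h → suc (g Q ℕ.+ _) < 2 ℕ.* (2 ℕ.* h)) Q+s≡h
            (gap+gap<4*[q+s] s n≤3q (s≤s⁻¹ (toℕ<n (punchIn (inject₁ q) j)))))
          λ eq →
          punchInᵢ≢i (inject₁ q) j (toℕ-injective (≡.trans
            (gap≡q⇒i≡q (toℕ q) s _ (ℕ.suc-injective (ℕ.+-cancelˡ-≡ (g Q) _ _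
              (≡.trans (ℕ.+-suc (g Q) _) (≡.trans eq 2h≡gQ+Q)))))
            (≡.sym (toℕ-inject₁ q))))

      -- Induction on the number `p` of pairs still to be removed. Writing the size as `p * 2 + m`
      -- lets each step peel off two `suc` by computation.
      det-gapHankel : ∀ p m s → p ℕ.+ m ℕ.+ s ≡ 2 ℕ.^ e →
        det (gapHankel (p ℕ.+ m) s (p ℕ.* 2 ℕ.+ m)) ≈ (- (y * y)) ^ p * d x m
      -- All `m` remaining positions lie below the gap, where `gap` is the identity.
      det-gapHankel zero m s eq = trans
        (det-cong {m} λ i j → reflexive (cong₂ (λ u v → a x (u ℕ.+ v)) (gap-< s (toℕ<n i)) (gap-< s (toℕ<n j))))
        (sym (*-identityˡ _))
      det-gapHankel (suc p) m s eq = begin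
        det (gapHankel (suc (p ℕ.+ m)) s (suc p ℕ.* 2 ℕ.+ m))
          ≈⟨ step ⟩
        - (y * y) * det (gapHankel (p ℕ.+ m) (suc s) (p ℕ.* 2 ℕ.+ m))
          ≈⟨ *-congˡ (det-gapHankel p m (suc s) (≡.trans (ℕ.+-suc (p ℕ.+ m) s) eq)) ⟩
        - (y * y) * ((- (y * y)) ^ p * d x m)
          ≈⟨ *-assoc _ _ _ ⟨
        (- (y * y)) ^ suc p * d x m ∎
        where
        q<n : p ℕ.+ m < suc (p ℕ.* 2 ℕ.+ m)
        q<n = s≤s (ℕ.+-monoˡ-≤ m (ℕ.m≤m*n p 2))

        n≤3q : p ℕ.* 2 ℕ.+ m ≤ 3 ℕ.* (p ℕ.+ m)
        n≤3q = ℕ.≤-trans (ℕ.m≤m+n _ (p ℕ.+ (m ℕ.+ m))) (ℕ.≤-reflexive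
          (let open NS in
           NS.solve 2 (λ p m → (p :* con 2 :+ m) :+ (p :+ (m :+ m)) := con 3 :* (p :+ m)) ≡.refl p m))

        step : det (gapHankel (suc (p ℕ.+ m)) s (suc p ℕ.* 2 ℕ.+ m)) ≈
               - (y * y) * det (gapHankel (p ℕ.+ m) (suc s) (p ℕ.* 2 ℕ.+ m))
        -- The position is an element of `Fin`, so its value `toℕ (fromℕ< q<n)` is transported to
        -- `p + m`.
        step = subst
          (λ q → suc q ℕ.+ s ≡ 2 ℕ.^ e → p ℕ.* 2 ℕ.+ m ≤ 3 ℕ.* q →
            det (gapHankel (suc q) s (suc p ℕ.* 2 ℕ.+ m)) ≈ - (y * y) * det (gapHankel q (suc s) (p ℕ.* 2 ℕ.+ m)))
          (toℕ-fromℕ< q<n) (det-gapHankel-step (fromℕ< q<n) s) eq n≤3q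

      -- The process starts from an empty gap at h = `p + m`, and the size `p * 2 + m` is h + p.
      d-recurrence : ∀ p m → p ℕ.+ m ≡ 2 ℕ.^ e → d x (p ℕ.* 2 ℕ.+ m) ≈ (- (y * y)) ^ p * d x m
      d-recurrence p m eq = trans
        (det-cong {p ℕ.* 2 ℕ.+ m} λ i j → reflexive (≡.sym (cong₂ (λ u v → a x (u ℕ.+ v))
          (gap-zero (p ℕ.+ m) (toℕ i)) (gap-zero (p ℕ.+ m) (toℕ j)))))
        (det-gapHankel p m 0 (≡.trans (ℕ.+-identityʳ (p ℕ.+ m)) eq))

    -- Small values and the recurrence.

    d1≈x0 : d x 1 ≈ x 0
    d1≈x0 = begin
      1# * (a x 0 * 1#) + 0#    ≈⟨ +-identityʳ _ ⟩
      1# * (a x 0 * 1#)         ≈⟨ *-identityˡ _ ⟩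
      a x 0 * 1#                ≈⟨ *-identityʳ _ ⟩
      a x 0                     ≈⟨ a-power 0 ≡.refl ⟩
      x 0                       ∎

    d2≈-x1² : d x 2 ≈ - (x 1 ^ 2)
    d2≈-x1² = begin
      -- Here h = 1, `p = 1` and `m = 0`, so `y` is `x 1` and the remaining determinant is `1#`.
      d x 2                         ≈⟨ d-recurrence 0 1 0 ≡.refl ⟩
      (- (x 1 * x 1) * 1#) * 1#     ≈⟨ trans (*-identityʳ _) (*-identityʳ _) ⟩
      - (x 1 * x 1)                 ≈⟨ -‿cong (*-congˡ (*-identityʳ (x 1))) ⟨
      - (x 1 ^ 2)                   ∎

    -- Taking h as `2 ^ suc e` makes it visibly even, as the sign requires; `m` is then 2h - n.
    d-fold : ∀ e {p m} → p ℕ.+ m ≡ 2 ℕ.^ suc e → let k = suc (suc e); n = 2 ℕ.^ suc e ℕ.+ p in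
      d x n ≈ (- 1#) ^ n * (x (2 ℕ.^ k ∸ 1) ^ (2 ℕ.* n ∸ 2 ℕ.^ k) * d x (2 ℕ.^ k ∸ n))
    d-fold e {p} {m} p+m≡h = begin
      d x n
        ≡⟨ cong (d x) n≡p*2+m ⟩
      d x (p ℕ.* 2 ℕ.+ m)
        ≈⟨ d-recurrence (suc e) p m p+m≡h ⟩
      (- (y (suc e) * y (suc e))) ^ p * d x m
        ≈⟨ *-congʳ (-[y*y]^p≈-1^p*y^[2*p] (y (suc e)) p) ⟩
      ((- 1#) ^ p * y (suc e) ^ (2 ℕ.* p)) * d x m
        ≈⟨ *-assoc _ _ _ ⟩
      (- 1#) ^ p * (y (suc e) ^ (2 ℕ.* p) * d x m)
        ≈⟨ *-congʳ (-1^[2*m+n]≈-1^n (2 ℕ.^ e) p) ⟨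
      (- 1#) ^ n * (y (suc e) ^ (2 ℕ.* p) * d x m)
        ≡⟨ cong₂ (λ u v → (- 1#) ^ n * (y (suc e) ^ u * d x v)) 2n∸2h≡2p 2h∸n≡m ⟨
      (- 1#) ^ n * (y (suc e) ^ (2 ℕ.* n ∸ 2 ℕ.* h) * d x (2 ℕ.* h ∸ n)) ∎
      where
      h = 2 ℕ.^ suc e
      n = h ℕ.+ p

      n≡p*2+m : n ≡ p ℕ.* 2 ℕ.+ m
      n≡p*2+m = ≡.trans (cong (ℕ._+ p) (≡.sym p+m≡h))
        (let open NS in NS.solve 2 (λ p m → (p :+ m) :+ p := p :* con 2 :+ m) ≡.refl p m)

      2n∸2h≡2p : 2 ℕ.* n ∸ 2 ℕ.* h ≡ 2 ℕ.* p
      2n∸2h≡2p = ≡.trans (≡.sym (ℕ.*-distribˡ-∸ 2 n h)) (cong (2 ℕ.*_) (ℕ.m+n∸m≡n h p))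

      2h∸n≡m : 2 ℕ.* h ∸ n ≡ m
      -- `2 * h` unfolds to `h + (h + 0)`, so one copy of `h` cancels against `n`.
      2h∸n≡m = ≡.trans (ℕ.[m+n]∸[m+o]≡n∸o h (h ℕ.+ 0) p)
        (≡.trans (cong (_∸ p) (≡.trans (ℕ.+-identityʳ h) (≡.sym p+m≡h))) (ℕ.m+n∸m≡n p m))

theorem4p5 : ∀ {c ℓ} (R : CommutativeRing c ℓ) (x : ℕ → CommutativeRing.Carrier R) →
    let open CommutativeRing R
        open HankelDeterminant R in
      (d x 0 ≈ 1#)
    × (d x 1 ≈ x 0)
    × (d x 2 ≈ - (x 1 ^ 2))
    × (∀ (k n : ℕ) → 1 < 2 ℕ.^ (k ∸ 1) → 2 ℕ.^ (k ∸ 1) < n → n ≤ 2 ℕ.^ k →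
         d x n ≈ (- 1#) ^ n * (x (2 ℕ.^ k ∸ 1) ^ (2 ℕ.* n ∸ 2 ℕ.^ k) * d x (2 ℕ.^ k ∸ n)))
theorem4p5 R x = CommutativeRing.refl R , d1≈x0 R x , d2≈-x1² R x , λ
  -- For `k` equal to 0 or 1, `2 ^ (k ∸ 1)` is 1; truncated subtraction matters at 0.
  { zero          n 1<1 _ _ → contradiction 1<1 (ℕ.<-irrefl ≡.refl)
  ; (suc zero)    n 1<1 _ _ → contradiction 1<1 (ℕ.<-irrefl ≡.refl)
  ; (suc (suc e)) n _ h<n n≤2h → fold e n (ℕ.m≤n⇒∃[o]m+o≡n (ℕ.<⇒≤ h<n)) n≤2h
  }
  where
  open CommutativeRing R hiding (zero)
  open HankelDeterminant R

  fold : ∀ e n → (∃ λ p → 2 ℕ.^ suc e ℕ.+ p ≡ n) → n ≤ 2 ℕ.^ suc (suc e) →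
    let k = suc (suc e) in
    d x n ≈ (- 1#) ^ n * (x (2 ℕ.^ k ∸ 1) ^ (2 ℕ.* n ∸ 2 ℕ.^ k) * d x (2 ℕ.^ k ∸ n))
  -- Cancelling h in h + p ≤ 2h gives p ≤ h, so `m` can be taken as h - p.
  fold e n (p , ≡.refl) n≤2h = d-fold R x e (ℕ.m+[n∸m]≡n
    (subst (p ≤_) (ℕ.+-identityʳ _) (ℕ.+-cancelˡ-≤ (2 ℕ.^ suc e) _ _ n≤2h)))
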